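{- Let $d\ge 3$ be an integer such that $d$ is odd or $d\equiv 0\pmod 4$. Then the hypercube $Q_d$ is $\mathbb{Z}_2^d$-distance antimagic.
   Context: $Q_d$ is the graph with vertex set $\mathbb{Z}_2^d$ (binary strings of length $d$), two vertices adjacent iff they differ in exactly one coordinate. For a graph $G$ with $n$ vertices and an Abelian group $A$ of order $n$ (written additively), and a bijection $f:V(G)\to A$, the weight of $x$ is $w_f(x)=\sum_{y\in N(x)} f(y)$ computed in $A$ ($N(x)$ the open neighbourhood). $f$ is an $A$-distance antimagic labelling if all weights are pairwise distinct; $G$ is $A$-distance antimagic if it admits such a labelling. -}

module Defs where

open import Algebra.Bundles using (AbelianGroup)
import Data.Fin.Properties as Fin
open import Data.List.Base using (List; []; _∷_; _++_; map; filter; foldr)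
open import Data.List.Membership.Propositional using (_∈_)
open import Data.List.Membership.Propositional.Properties
  using (∈-++⁺ˡ; ∈-++⁺ʳ; ∈-map⁺; ∈-map⁻)
open import Data.List.Relation.Unary.Any using (here)
import Data.List.Relation.Unary.All as All
open import Data.List.Relation.Unary.AllPairs using ([]; _∷_)
open import Data.List.Relation.Unary.Unique.Propositional using (Unique)
import Data.List.Relation.Unary.Unique.Propositional.Properties as Unique
open import Data.Nat.Base using (ℕ; zero; suc)
open import Data.Parity.Base using (Parity; 0ℙ; 1ℙ) renaming (_+_ to _+ℙ_)
import Data.Parity.Properties as ℙ
open import Data.Product using (∃!; Σ-syntax; _×_; _,_)
open import Data.Vec.Base as Vec using (Vec; []; _∷_; lookup; replicate; zipWith)
import Data.Vec.Properties as Vec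
open import Function.Base using (id)
open import Function.Definitions using (Bijective)
open import Level using (Level; 0ℓ; _⊔_)
open import Relation.Binary.Core using (Rel)
open import Relation.Binary.Definitions using (Decidable; Irreflexive; Symmetric)
open import Relation.Binary.PropositionalEquality
  using (_≡_; _≢_; refl; sym; cong₂; isEquivalence)
open import Relation.Nullary.Decidable using (map′; ¬?; _×-dec_; _→-dec_)
open import Relation.Nullary.Negation using (¬_)

record FiniteSimpleGraph : Set₁ where
  field
    V               : Set
    vertices        : List V
    vertices-unique : Unique vertices
    vertices-all    : ∀ v → v ∈ vertices
    Adj             : Rel V 0ℓ
    adj?            : Decidable Adj
    adj-sym         : Symmetric Adj
    adj-irrefl      : Irreflexive _≡_ Adj

  N : V → List V
  N x = filter (adj? x) vertices

module _ {c ℓ : Level} (G : FiniteSimpleGraph) (A : AbelianGroup c ℓ) where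
  open FiniteSimpleGraph G
  open AbelianGroup A using (Carrier; _≈_) renaming (_∙_ to _+_; ε to 0#)

  weight : (V → Carrier) → V → Carrier
  weight f x = foldr _+_ 0# (map f (N x))

  -- Bijectivity forces the order of A to be the number of vertices of G.
  IsDistanceAntimagicLabelling : (V → Carrier) → Set (c ⊔ ℓ)
  IsDistanceAntimagicLabelling f =
    Bijective _≡_ _≈_ f ×
    (∀ (x y : V) → x ≢ y → ¬ (weight f x ≈ weight f y))

  DistanceAntimagic : Set (c ⊔ ℓ)
  DistanceAntimagic = Σ[ f ∈ (V → Carrier) ] IsDistanceAntimagicLabelling f

-- Parity with _+ℙ_ is ℤ₂; every element is its own inverse.
ℤ₂^ : ℕ → AbelianGroup 0ℓ 0ℓ
ℤ₂^ d = record
  { Carrier = Vec Parity d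
  ; _≈_     = _≡_
  ; _∙_     = zipWith _+ℙ_
  ; ε       = replicate d 0ℙ
  ; _⁻¹     = id
  ; isAbelianGroup = record
    { isGroup = record
      { isMonoid = record
        { isSemigroup = record
          { isMagma = record
            { isEquivalence = isEquivalence
            ; ∙-cong        = cong₂ (zipWith _+ℙ_)
            }
          ; assoc = Vec.zipWith-assoc ℙ.+-assoc
          }
        ; identity = Vec.zipWith-identityˡ ℙ.+-identityˡ
                   , Vec.zipWith-identityʳ ℙ.+-identityʳ
        }
      ; inverse = self-inverse , self-inverse
      ; ⁻¹-cong = id
      }
    ; comm = Vec.zipWith-comm ℙ.+-comm
    }
  }
  where
  self-inverse : ∀ {n} (x : Vec Parity n) → zipWith _+ℙ_ x x ≡ replicate n 0ℙ
  self-inverse []      = refl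
  self-inverse (p ∷ x) = cong₂ _∷_ (ℙ.p+p≡0ℙ p) (self-inverse x)

strings : ∀ d → List (Vec Parity d)
strings zero    = [] ∷ []
strings (suc d) = map (0ℙ ∷_) (strings d) ++ map (1ℙ ∷_) (strings d)

strings-unique : ∀ d → Unique (strings d)
strings-unique zero    = All.[] ∷ []
strings-unique (suc d) = Unique.++⁺
  (Unique.map⁺ Vec.∷-injectiveʳ (strings-unique d))
  (Unique.map⁺ Vec.∷-injectiveʳ (strings-unique d))
  disjoint
  where
  disjoint : ∀ {v} → ¬ (v ∈ map (0ℙ ∷_) (strings d) × v ∈ map (1ℙ ∷_) (strings d))
  disjoint (p , q) with ∈-map⁻ (0ℙ ∷_) p | ∈-map⁻ (1ℙ ∷_) q
  ... | _ , _ , refl | _ , _ , ()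

strings-all : ∀ {d} (v : Vec Parity d) → v ∈ strings d
strings-all []       = here refl
strings-all (0ℙ ∷ v) = ∈-++⁺ˡ (∈-map⁺ (0ℙ ∷_) (strings-all v))
strings-all {suc d} (1ℙ ∷ v) =
  ∈-++⁺ʳ (map (0ℙ ∷_) (strings d)) (∈-map⁺ (1ℙ ∷_) (strings-all v))

DifferInExactlyOne : ∀ {d} → Rel (Vec Parity d) 0ℓ
DifferInExactlyOne x y = ∃! _≡_ λ i → lookup x i ≢ lookup y i

differInExactlyOne? : ∀ {d} → Decidable (DifferInExactlyOne {d})
differInExactlyOne? x y =
  map′ (λ (i , p , u) → i , p , λ {j} → u j)
       (λ (i , p , u) → i , p , λ j → u {j})
       (Fin.any? λ i → differ? i ×-dec Fin.all? λ j → differ? j →-dec (i Fin.≟ j))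
  where
  differ? = λ i → ¬? (lookup x i ℙ.≟ lookup y i)

Q : ℕ → FiniteSimpleGraph
Q d = record
  { V               = Vec Parity d
  ; vertices        = strings d
  ; vertices-unique = strings-unique d
  ; vertices-all    = strings-all
  ; Adj             = DifferInExactlyOne
  ; adj?            = differInExactlyOne?
  ; adj-sym         = λ (i , p , u) → i , (λ e → p (sym e)) , λ q → u (λ e → q (sym e))
  ; adj-irrefl      = λ { refl (_ , p , _) → p refl }
  }

{-# OPTIONS --safe #-}

-- For d odd the identity of ℤ₂ᵈ is a labelling: its weights are x ↦ x + (1,…,1).
-- Concatenating labellings of Q m and Q n, with m and n even, labels Q (m + n): moving along
-- an edge of one factor repeats the label of the other factor an even number of times, so the
-- weights are concatenated as well.  Hence Q 4k reduces to one explicit labelling of Q 4.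
module Submission where

open import Defs
open import Algebra.Bundles using (AbelianGroup)
import Algebra.Properties.Monoid.Mult as Mult
import Algebra.Properties.Monoid.Sum as Sum
open import Data.Fin.Base using (Fin; zero; suc)
import Data.Fin.Properties as Fin
open import Data.List.Base as List using (foldr)
open import Data.List.Membership.Propositional using (_∈_; lose)
open import Data.List.Membership.Propositional.Properties
  using (∈-filter⁺; ∈-filter⁻; ∈-tabulate⁺; ∈-tabulate⁻)
open import Data.List.Membership.Propositional.Properties.WithK using (unique∧set⇒bag)
open import Data.List.Properties using (map-tabulate)
import Data.List.Relation.Unary.All as All
import Data.List.Relation.Unary.Any as Any
open import Data.List.Relation.Binary.BagAndSetEquality using (∼bag⇒↭)
open import Data.List.Relation.Binary.Permutation.Propositional using (_↭_; ↭⇒↭ₛ′)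
open import Data.List.Relation.Binary.Permutation.Propositional.Properties using (map⁺)
open import Data.List.Relation.Binary.Permutation.Setoid.Properties using (foldr-commMonoid)
import Data.List.Relation.Unary.Unique.Propositional.Properties as Unique
open import Data.Nat.Base using (ℕ; zero; suc; _≤_) renaming (_+_ to _+ℕ_; _*_ to _*ℕ_)
open import Data.Nat.Divisibility using (_∣_; divides; ∣n⇒∣m*n; m%n≡0⇒n∣m)
open import Data.Nat.DivMod using (_%_; _/_; m≡m%n+[m/n]*n)
open import Data.Parity.Base using (Parity; 0ℙ; 1ℙ; _⁻¹) renaming (_+_ to _+ℙ_; _*_ to infixl 8 _*ℙ_)
import Data.Parity.Properties as ℙ
open import Data.Product using (Σ-syntax; _×_; _,_; proj₁; proj₂)
open import Data.Sum.Base using (_⊎_; inj₁; inj₂)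
open import Data.Unit.Base using (tt)
open import Data.Vec.Base
  using (Vec; []; _∷_; _++_; lookup; map; splitAt; take; drop; updateAt)
open import Data.Vec.Properties
  using (++-injective; ∷-injectiveˡ; ∷-injectiveʳ; lookup∘updateAt; lookup∘updateAt′; take++drop≡id;
   ≡-dec; zipWith-++)
import Data.Vec.Relation.Binary.Pointwise.Extensional as Pointwise
open import Function.Base using (id; _∘_)
open import Function.Bundles using (mk⇔)
open import Function.Definitions using (Bijective; Injective; Surjective)
open import Relation.Binary.Definitions using (DecidableEquality)
open import Relation.Binary.PropositionalEquality
  using (_≡_; _≢_; refl; sym; trans; cong; cong₂; subst; module ≡-Reasoning)
open import Relation.Nullary.Decidable using (Dec; yes; no; map′; toWitness; _→-dec_)
open import Relation.Nullary.Negation using (contradiction)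

private variable
  a b d m n : ℕ

open module ℤ₂ {d} = AbelianGroup (ℤ₂^ d)
  using () renaming
  ( _∙_ to _+_; ε to 0#; assoc to +-assoc; identityˡ to +-identityˡ; identityʳ to +-identityʳ
  ; inverseʳ to x+x≡0 )
open module ℤ₂-Mult {d} = Mult (AbelianGroup.monoid (ℤ₂^ d)) using () renaming (_×_ to _·_)
open module ℤ₂-Sum {d} = Sum (AbelianGroup.monoid (ℤ₂^ d)) using (sum)

_≟_ : DecidableEquality (Vec Parity d)
_≟_ = ≡-dec ℙ._≟_

-- Neighbourhoods and weights through coordinate flips

flip : Vec Parity d → Fin d → Vec Parity d
flip x i = updateAt x i _⁻¹

≢⇒≡⁻¹ : ∀ {p q} → p ≢ q → q ≡ p ⁻¹
≢⇒≡⁻¹ {0ℙ} {0ℙ} p≢q = contradiction refl p≢q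
≢⇒≡⁻¹ {0ℙ} {1ℙ} p≢q = refl
≢⇒≡⁻¹ {1ℙ} {0ℙ} p≢q = refl
≢⇒≡⁻¹ {1ℙ} {1ℙ} p≢q = contradiction refl p≢q

flip-adj : (x : Vec Parity d) (i : Fin d) → DifferInExactlyOne x (flip x i)
flip-adj x i = i , differs , only
  where
  differs : lookup x i ≢ lookup (flip x i) i
  differs eq = ℙ.p≢p⁻¹ (lookup x i) (trans eq (lookup∘updateAt i x))

  only : ∀ {j} → lookup x j ≢ lookup (flip x i) j → i ≡ j
  only {j} ne with i Fin.≟ j
  ... | yes i≡j = i≡j
  ... | no  i≢j = contradiction (sym (lookup∘updateAt′ j i (i≢j ∘ sym) x)) ne

adj⇒flip : {x y : Vec Parity d} ((i , _) : DifferInExactlyOne x y) → y ≡ flip x i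
adj⇒flip {x = x} {y} (i , differs , only) = Pointwise.Pointwise-≡⇒≡ (Pointwise.ext agree)
  where
  agree : ∀ j → lookup y j ≡ lookup (flip x i) j
  agree j with i Fin.≟ j
  ... | yes refl = trans (≢⇒≡⁻¹ differs) (sym (lookup∘updateAt i x))
  ... | no  i≢j with lookup x j ℙ.≟ lookup y j
  ...   | yes eq = trans (sym eq) (sym (lookup∘updateAt′ j i (i≢j ∘ sym) x))
  ...   | no  ne = contradiction (only ne) i≢j

flip-injective : (x : Vec Parity d) → Injective _≡_ _≡_ (flip x)
flip-injective x {i} {j} eq =
  -- If the two flips agree, then `x` differs from `flip x i` also at `j`, and the differing
  -- coordinate is unique.
  proj₂ (proj₂ (flip-adj x i))
    λ e → proj₁ (proj₂ (flip-adj x j)) (trans e (cong (λ v → lookup v j) eq))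

-- Both lists are duplicate-free with the same members, so they agree up to order, which a sum in a
-- commutative group ignores.
N↭flips : (x : Vec Parity d) → FiniteSimpleGraph.N (Q d) x ↭ List.tabulate (flip x)
N↭flips {d} x = ∼bag⇒↭ (unique∧set⇒bag
  (Unique.filter⁺ (differInExactlyOne? x) (strings-unique d))
  (Unique.tabulate⁺ (flip-injective x))
  (mk⇔ to from))
  where
  to : ∀ {y} → y ∈ FiniteSimpleGraph.N (Q d) x → y ∈ List.tabulate (flip x)
  to y∈N with ∈-filter⁻ (differInExactlyOne? x) {xs = strings d} y∈N
  ... | _ , adj@(i , _) = subst (_∈ _) (sym (adj⇒flip adj)) (∈-tabulate⁺ i)

  from : ∀ {y} → y ∈ List.tabulate (flip x) → y ∈ FiniteSimpleGraph.N (Q d) x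
  from y∈ with ∈-tabulate⁻ y∈
  ... | i , refl = ∈-filter⁺ (differInExactlyOne? x) (strings-all _) (flip-adj x i)

-- The label dimension `a` is independent of `d`, so fixing a vertex coordinate, as in `f ∘ (p ∷_)`,
-- leaves the labels unchanged and allows induction on `d`.
neighbourSum : (Vec Parity d → Vec Parity a) → Vec Parity d → Vec Parity a
neighbourSum f x = sum (f ∘ flip x)

foldr-tabulate : (t : Fin n → Vec Parity a) → foldr _+_ 0# (List.tabulate t) ≡ sum t
foldr-tabulate {zero}  t = refl
foldr-tabulate {suc n} t = cong (t zero +_) (foldr-tabulate (t ∘ suc))

weight≡neighbourSum : (f : Vec Parity d → Vec Parity a) (x : Vec Parity d) →
                      weight (Q d) (ℤ₂^ a) f x ≡ neighbourSum f x
weight≡neighbourSum {d} {a} f x = begin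
  weight (Q d) (ℤ₂^ a) f x
    ≡⟨ foldr-commMonoid ℤ₂.setoid ℤ₂.isCommutativeMonoid
         (↭⇒↭ₛ′ ℤ₂.isEquivalence (map⁺ f (N↭flips x))) ⟩
  foldr _+_ 0# (List.map f (List.tabulate (flip x)))
    ≡⟨ cong (foldr _+_ 0#) (map-tabulate (flip x) f) ⟩
  foldr _+_ 0# (List.tabulate (f ∘ flip x))
    ≡⟨ foldr-tabulate (f ∘ flip x) ⟩
  neighbourSum f x ∎
  where open ≡-Reasoning

Labelling : (Vec Parity d → Vec Parity d) → Set
Labelling f = Bijective _≡_ _≡_ f × Injective _≡_ _≡_ (neighbourSum f)

labelling⇒antimagic : {f : Vec Parity d → Vec Parity d} → Labelling f →
                      DistanceAntimagic (Q d) (ℤ₂^ d)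
labelling⇒antimagic {f = f} (bij , inj) = f , bij , λ x y x≢y eq →
  x≢y (inj (trans (sym (weight≡neighbourSum f x)) (trans eq (weight≡neighbourSum f y))))

-- Neighbour sums over concatenated strings

0#-++ : ∀ a → 0# {a +ℕ b} ≡ 0# {a} ++ 0#
0#-++ zero    = refl
0#-++ (suc a) = cong (0ℙ ∷_) (0#-++ a)

sum-constˡ-++ : (u : Vec Parity a) {s : Fin n → Vec Parity (a +ℕ b)} {t : Fin n → Vec Parity b} →
                (∀ i → s i ≡ u ++ t i) → sum s ≡ n · u ++ sum t
sum-constˡ-++ {a} {zero}  u eq = 0#-++ a
sum-constˡ-++ {a} {suc n} u eq = trans
  (cong₂ _+_ (eq zero) (sum-constˡ-++ u (eq ∘ suc)))
  (zipWith-++ _+ℙ_ u _ (n · u) _)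

-- Each of the `n` flips in `y` repeats the label `f x`, and each of the `m` flips in `x` repeats
-- `g y`. Taking `h` arbitrary subject to the splitting equation lets the induction on `x` pass to
-- `f ∘ (p ∷_)` and `h ∘ (p ∷_)`.
neighbourSum-++ :
  (f : Vec Parity m → Vec Parity a) (g : Vec Parity n → Vec Parity b)
  (h : Vec Parity (m +ℕ n) → Vec Parity (a +ℕ b)) →
  (∀ x y → h (x ++ y) ≡ f x ++ g y) →
  ∀ x y → neighbourSum h (x ++ y) ≡
          (neighbourSum f x + n · f x) ++ (m · g y + neighbourSum g y)
neighbourSum-++ {n = n} f g h eq [] y = trans
  (sum-constˡ-++ (f []) (eq [] ∘ flip y))
  (sym (cong₂ _++_ (+-identityˡ (n · f [])) (+-identityˡ (neighbourSum g y))))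
neighbourSum-++ {m = suc m} {n = n} f g h eq (p ∷ x) y = begin
  -- The first summand flips `p`; all the others keep it fixed.
  h (p ⁻¹ ∷ x ++ y) + neighbourSum (h ∘ (p ∷_)) (x ++ y)
    ≡⟨ cong₂ _+_ (eq (p ⁻¹ ∷ x) y) (neighbourSum-++ (f ∘ (p ∷_)) g (h ∘ (p ∷_)) (eq ∘ (p ∷_)) x y) ⟩
  (f (p ⁻¹ ∷ x) ++ g y) +
  ((neighbourSum (f ∘ (p ∷_)) x + n · f (p ∷ x)) ++ (m · g y + neighbourSum g y))
    ≡⟨ zipWith-++ _+ℙ_ (f (p ⁻¹ ∷ x)) _ _ _ ⟩
  (f (p ⁻¹ ∷ x) + (neighbourSum (f ∘ (p ∷_)) x + n · f (p ∷ x))) ++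
  (g y + (m · g y + neighbourSum g y))
    ≡⟨ cong₂ _++_ (+-assoc (f (p ⁻¹ ∷ x)) _ _) (+-assoc (g y) _ _) ⟨
  (neighbourSum f (p ∷ x) + n · f (p ∷ x)) ++ (suc m · g y + neighbourSum g y) ∎
  where open ≡-Reasoning

-- Parity of multiples and the odd case

double·≡0 : ∀ k (x : Vec Parity a) → (k *ℕ 2) · x ≡ 0#
double·≡0 zero    x = refl
double·≡0 (suc k) x = trans (cong (λ v → x + (x + v)) (double·≡0 k x))
  (trans (cong (x +_) (+-identityʳ x)) (x+x≡0 x))

even·≡0 : 2 ∣ n → (x : Vec Parity a) → n · x ≡ 0#
even·≡0 (divides k refl) = double·≡0 k

odd·≡id : 2 ∣ n → (x : Vec Parity a) → suc n · x ≡ x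
odd·≡id even x = trans (cong (x +_) (even·≡0 even x)) (+-identityʳ x)

-- In odd dimension the sum consists of an odd number of copies of `x`, and each coordinate is
-- flipped in exactly one of them. Splitting off two coordinates at a time keeps the dimension odd.
neighbourSum-id : ∀ k (x : Vec Parity (suc (k *ℕ 2))) → neighbourSum id x ≡ map _⁻¹ x
neighbourSum-id zero    (p ∷ [])    = cong (_∷ []) (ℙ.+-identityʳ (p ⁻¹))
neighbourSum-id (suc k) (p ∷ q ∷ x) = begin
  neighbourSum id (p ∷ q ∷ x)
    ≡⟨ neighbourSum-++ id id id (λ _ _ → refl) (p ∷ q ∷ []) x ⟩
  (neighbourSum id pq + suc (k *ℕ 2) · pq) ++ (2 · x + neighbourSum id x)
    ≡⟨ cong₂ _++_ (cong (neighbourSum id pq +_) (odd·≡id (divides k refl) pq))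
                  (cong₂ _+_ (double·≡0 1 x) (neighbourSum-id k x)) ⟩
  (neighbourSum id pq + pq) ++ (0# + map _⁻¹ x)
    ≡⟨ cong₂ _++_ (two p q) (+-identityˡ (map _⁻¹ x)) ⟩
  map _⁻¹ (p ∷ q ∷ x) ∎
  where
  open ≡-Reasoning
  pq : Vec Parity 2
  pq = p ∷ q ∷ []

  -- The two neighbours of `p ∷ q ∷ []` sum to the all-ones vector, and adding that vector
  -- complements.
  two : ∀ p q → neighbourSum id (p ∷ q ∷ []) + (p ∷ q ∷ []) ≡ map _⁻¹ (p ∷ q ∷ [])
  two 0ℙ 0ℙ = refl
  two 0ℙ 1ℙ = refl
  two 1ℙ 0ℙ = refl
  two 1ℙ 1ℙ = refl

map-⁻¹-injective : Injective _≡_ _≡_ (map {n = d} _⁻¹)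
map-⁻¹-injective {x = []}    {[]}    _  = refl
map-⁻¹-injective {x = _ ∷ _} {_ ∷ _} eq =
  cong₂ _∷_ (ℙ.⁻¹-injective (∷-injectiveˡ eq)) (map-⁻¹-injective (∷-injectiveʳ eq))

id-labelling : ∀ k → Labelling {suc (k *ℕ 2)} id
id-labelling k = (id , λ y → y , id) , λ {x} {y} eq →
  map-⁻¹-injective (trans (sym (neighbourSum-id k x)) (trans eq (neighbourSum-id k y)))

-- Products of labellings

_⊗_ : (Vec Parity m → Vec Parity m) → (Vec Parity n → Vec Parity n) →
      Vec Parity (m +ℕ n) → Vec Parity (m +ℕ n)
_⊗_ {m} f g v = f (take m v) ++ g (drop m v)

⊗-++ : (f : Vec Parity m → Vec Parity m) (g : Vec Parity n → Vec Parity n) →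
       ∀ x y → (f ⊗ g) (x ++ y) ≡ f x ++ g y
⊗-++ {m} f g x y with take≡ , drop≡ ← ++-injective (take m (x ++ y)) x (take++drop≡id m (x ++ y)) =
  cong₂ (λ x y → f x ++ g y) take≡ drop≡

-- Stated for any `h` that splits, as it serves both `f ⊗ g` and its neighbour sum.
injective-++ : {f : Vec Parity m → Vec Parity m} {g : Vec Parity n → Vec Parity n}
               {h : Vec Parity (m +ℕ n) → Vec Parity (m +ℕ n)} →
               (∀ x y → h (x ++ y) ≡ f x ++ g y) →
               Injective _≡_ _≡_ f → Injective _≡_ _≡_ g → Injective _≡_ _≡_ h
injective-++ {m} {f = f} h-++ f-inj g-inj {v} {w} eq
  with x , y , refl ← splitAt m v | x′ , y′ , refl ← splitAt m w
  with fx≡ , gy≡ ← ++-injective (f x) (f x′) (trans (sym (h-++ x y)) (trans eq (h-++ x′ y′)))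
  = cong₂ _++_ (f-inj fx≡) (g-inj gy≡)

⊗-labelling : {f : Vec Parity m → Vec Parity m} {g : Vec Parity n → Vec Parity n} →
              2 ∣ m → 2 ∣ n → Labelling f → Labelling g → Labelling (f ⊗ g)
⊗-labelling {m} {n} {f} {g} 2∣m 2∣n ((f-inj , f-sur) , f-sum) ((g-inj , g-sur) , g-sum) =
  (injective-++ (⊗-++ f g) f-inj g-inj , surjective) , injective-++ sum-++ f-sum g-sum
  where
  sum-++ : ∀ x y → neighbourSum (f ⊗ g) (x ++ y) ≡ neighbourSum f x ++ neighbourSum g y
  -- The cross terms `n · f x` and `m · g y` vanish because `n` and `m` are even.
  sum-++ x y = trans (neighbourSum-++ f g (f ⊗ g) (⊗-++ f g) x y) (cong₂ _++_
    (trans (cong (neighbourSum f x +_) (even·≡0 2∣n (f x))) (+-identityʳ (neighbourSum f x)))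
    (trans (cong (_+ neighbourSum g y) (even·≡0 2∣m (g y))) (+-identityˡ (neighbourSum g y))))

  surjective : Surjective _≡_ _≡_ (f ⊗ g)
  surjective v with x , y , refl ← splitAt m v with x₀ , fx₀ ← f-sur x | y₀ , gy₀ ← g-sur y =
    x₀ ++ y₀ , λ { refl → trans (⊗-++ f g x₀ y₀) (cong₂ _++_ (fx₀ refl) (gy₀ refl)) }

-- Found by computer search.  The weight of (x₀ , x₁ , x₂ , x₃) is
-- (1 + x₁ + x₂ , 1 + x₂ + x₃ , x₀ + x₂ , x₀ + x₃ + x₁x₂ + x₁x₃ + x₂x₃).
f₄ : Vec Parity 4 → Vec Parity 4
f₄ (x₀ ∷ x₁ ∷ x₂ ∷ x₃ ∷ []) =
  (x₀ +ℙ x₁ *ℙ x₂) ∷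
  (x₁ +ℙ x₂ *ℙ x₃) ∷
  (x₀ +ℙ x₀ *ℙ x₂ +ℙ x₃) ∷
  (x₂ +ℙ x₃ +ℙ x₀ *ℙ x₃ +ℙ x₁ *ℙ x₂ *ℙ x₃) ∷ []

injective? : (f : Vec Parity d → Vec Parity d) →
             Dec (∀ x y → f x ≡ f y → x ≡ y)
injective? {d} f = map′
  (λ all x y → All.lookup (All.lookup all (strings-all x)) (strings-all y))
  (λ inj → All.universal (λ x → All.universal (inj x) (strings d)) (strings d))
  (All.all? (λ x → All.all? (λ y → f x ≟ f y →-dec x ≟ y) (strings d)) (strings d))

surjective? : (f : Vec Parity d → Vec Parity d) → Dec (∀ y → Σ[ x ∈ Vec Parity d ] f x ≡ y)
surjective? {d} f = map′
  (λ all y → Any.satisfied (All.lookup all (strings-all y)))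
  (λ sur → All.universal (λ y → let x , eq = sur y in lose (strings-all x) eq) (strings d))
  (All.all? (λ y → Any.any? (λ x → f x ≟ y) (strings d)) (strings d))

-- Settled by evaluation: the deciders run through all 16 strings, or all pairs of them, and `tt` is
-- accepted because they compute to `yes`.
f₄-labelling : Labelling f₄
f₄-labelling =
  ( (λ {x} {y} → toWitness {a? = injective? f₄} tt x y)
  , (λ y → let x , eq = toWitness {a? = surjective? f₄} tt y in x , λ { refl → eq }) ) ,
  (λ {x} {y} → toWitness {a? = injective? (neighbourSum f₄)} tt x y)

4∣⇒labelling : ∀ k → Σ[ f ∈ (Vec Parity (k *ℕ 4) → Vec Parity (k *ℕ 4)) ] Labelling f
-- `Q 0` has a single vertex, so injectivity of the neighbour sum is trivial.
4∣⇒labelling zero    = id , (id , λ y → y , id) , λ { {[]} {[]} _ → refl }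
4∣⇒labelling (suc k) with f , f-lab ← 4∣⇒labelling k =
  f₄ ⊗ f , ⊗-labelling (divides 2 refl) (∣n⇒∣m*n k (divides 2 refl)) f₄-labelling f-lab

mainTheorem8 : (d : ℕ) → 3 ≤ d → (d % 2 ≡ 1) ⊎ (d % 4 ≡ 0) →
    DistanceAntimagic (Q d) (ℤ₂^ d)
mainTheorem8 d _ (inj₁ d%2≡1) =
  -- Division with remainder rewrites `d` as `1 + (d / 2) * 2`, the form of dimension in
  -- `id-labelling`.
  subst (λ d → DistanceAntimagic (Q d) (ℤ₂^ d))
        (sym (trans (m≡m%n+[m/n]*n d 2) (cong (_+ℕ d / 2 *ℕ 2) d%2≡1)))
        (labelling⇒antimagic (id-labelling (d / 2)))
mainTheorem8 d _ (inj₂ d%4≡0) with divides k refl ← m%n≡0⇒n∣m d 4 d%4≡0 =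
  labelling⇒antimagic (proj₂ (4∣⇒labelling k))
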